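{- If $G$ is a cactus graph (a connected finite simple graph in which every two cycles are edge-disjoint), then $\operatorname{tlir}(G) \leq 2$.
   Context: Graphs are finite and simple. A total coloring of $G$ assigns a color to every vertex and every edge of $G$. For a color $c$ and a vertex $v$, the total $c$-degree of $v$ is the number of edges of color $c$ incident to $v$, plus $1$ if $v$ itself has color $c$ (plus $0$ otherwise). A total coloring is a locally irregular total coloring (TLIR coloring) if for every edge $uv$, letting $c$ be the color of $uv$, the total $c$-degrees of $u$ and $v$ are different (equivalently, each color class induces a locally irregular total graph, where vertices of that color are "full" and other endpoints of edges of that color are "empty"). $\operatorname{tlir}(G)$ is the minimum number of colors in a TLIR coloring of $G$. -}

module Defs where

open import Data.Nat using (ℕ; zero; suc; _+_; _≤_)
open import Data.Fin using (Fin; zero; suc; _≟_)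
open import Data.Bool using (Bool; true; false; _∧_; T; if_then_else_)
open import Data.List using (List; length; filterᵇ; allFin)
open import Data.Product using (Σ; ∃; _×_; _,_)
open import Data.Sum using (_⊎_)
open import Relation.Binary.PropositionalEquality using (_≡_; _≢_)
open import Relation.Nullary.Decidable using (⌊_⌋)
open import Function.Definitions using (Injective)

record Graph (n : ℕ) : Set where
  field
    adj    : Fin n → Fin n → Bool
    sym    : ∀ u v → adj u v ≡ adj v u
    irrefl : ∀ v → adj v v ≡ false

open Graph public

Adj : ∀ {n} → Graph n → Fin n → Fin n → Set
Adj G u v = T (adj G u v)

data Walk {n} (G : Graph n) : Fin n → Fin n → Set where
  here : ∀ {v} → Walk G v v
  step : ∀ {u v w} → Adj G u v → Walk G v w → Walk G u w

Connected : ∀ {n} → Graph n → Set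
Connected G = ∀ u v → Walk G u v

next : ∀ {k} → Fin (suc k) → Fin (suc k)
next {zero}  zero    = zero
next {suc k} zero    = suc zero
next {suc k} (suc i) with next {k} i
... | zero  = zero
... | suc j = suc (suc j)

record Cycle {n} (G : Graph n) : Set where
  field
    len   : ℕ
    vtx   : Fin (3 + len) → Fin n
    inj   : Injective _≡_ _≡_ vtx
    edges : ∀ i → Adj G (vtx i) (vtx (next i))

open Cycle public

CycleEdge : ∀ {n} {G : Graph n} → Cycle G → Fin n → Fin n → Set
CycleEdge C u v =
  ∃ λ i → (vtx C i ≡ u × vtx C (next i) ≡ v) ⊎ (vtx C i ≡ v × vtx C (next i) ≡ u)

-- Cactus: connected, and any two cycles sharing an edge are the same cycle
-- (same edge set), i.e. distinct cycles are edge-disjoint.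
Cactus : ∀ {n} → Graph n → Set
Cactus G = Connected G ×
  (∀ (C D : Cycle G) → (∃ λ u → ∃ λ v → CycleEdge C u v × CycleEdge D u v) →
     ∀ u v → CycleEdge C u v → CycleEdge D u v)

record TotalColoring {n} (G : Graph n) (k : ℕ) : Set where
  field
    vcol    : Fin n → Fin k
    ecol    : Fin n → Fin n → Fin k
    ecolSym : ∀ u v → ecol u v ≡ ecol v u

open TotalColoring public

tdeg : ∀ {n k} {G : Graph n} → TotalColoring G k → Fin n → Fin k → ℕ
tdeg {n} {G = G} φ v c =
  length (filterᵇ (λ w → adj G v w ∧ ⌊ ecol φ v w ≟ c ⌋) (allFin n))
  + (if ⌊ vcol φ v ≟ c ⌋ then 1 else 0)

IsTLIR : ∀ {n k} {G : Graph n} → TotalColoring G k → Set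
IsTLIR {G = G} φ =
  ∀ u v → Adj G u v → tdeg φ u (ecol φ u v) ≢ tdeg φ v (ecol φ u v)

TlirAtMost : ∀ {n} → Graph n → ℕ → Set
TlirAtMost G k = Σ (TotalColoring G k) IsTLIR

{-# OPTIONS --safe #-}

-- Fix for each vertex v a bit X v, and colour v so that its red total degree has the parity X v; its
-- blue total degree then has the parity of deg v + 1 + X v. Hence an edge between degrees of different
-- parity is settled by the parities if it is red when X differs and blue otherwise, and an edge between
-- degrees of the same parity is settled in either colour if X differs. Only the edges with equal X and
-- equal parity of the degree are bad.
--
-- Take the distance levels from a root with a tree of parents. In a cactus an edge inside a level is
-- the only such edge of its cycle, these edges form a matching, and an edge between consecutive levels
-- outside the tree lies on a cycle without them. Let X alternate along the tree, except that it is
-- twisted at the smaller end u of an edge inside a level when u and its parent have degrees of different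
-- parity. Then a bad edge uv lies inside a level, and the edge from u to its parent is free to take
-- either colour. One of the four colourings of these two edges separates u from v, whatever the rest of
-- the colouring is, and doing this by decreasing level never spoils a bad edge treated before.
module Submission where

open import Data.Bool as Bool using (Bool; true; false; T; not; _∧_; _xor_; if_then_else_)
import Data.Bool.Properties as Bool
open import Data.Bool.Properties using (T?; not-¬; ∧-zeroʳ; xor-same; xor-identityʳ)
open import Data.Empty using (⊥)
open import Data.Fin as Fin using (Fin; zero; suc; _≟_)
import Data.Fin.Properties as Fin
open import Data.Fin.Properties using (any?)
open import Data.List using (List; []; _∷_; length; lookup; filterᵇ; allFin; map)
open import Data.List.Extrema.Nat using (max; xs≤max)
open import Data.List.Membership.Propositional using (_∈_)
open import Data.List.Membership.Propositional.Properties using (∈-lookup; ∈-allFin; ∈-map⁺)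
open import Data.List.Relation.Unary.All as All using (All; []; _∷_)
open import Data.List.Relation.Unary.AllPairs using ([]; _∷_)
open import Data.List.Relation.Unary.Any using (here; there)
open import Data.List.Relation.Unary.Unique.Propositional using (Unique)
open import Data.List.Relation.Unary.Unique.Propositional.Properties using (allFin⁺)
open import Data.Nat using (ℕ; zero; suc; _+_; _≤_; _<_; z≤n; s≤s; s≤s⁻¹)
import Data.Nat.Properties as ℕ
open import Data.Product using (∃; _×_; _,_; proj₁; proj₂)
open import Data.Sum using (_⊎_; inj₁; inj₂; swap)
open import Data.Vec.Functional using (updateAt)
open import Data.Vec.Functional.Properties using (updateAt-updates; updateAt-minimal)
open import Function using (_∘_; const)
open import Relation.Binary.Definitions using (tri<; tri≈; tri>)
open import Relation.Binary.PropositionalEquality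
  using (_≡_; _≢_; refl; sym; trans; cong; cong₂; subst; subst₂)
open import Relation.Nullary using (Dec; yes; no; ¬_; contradiction)
open import Relation.Nullary.Decidable using (_×-dec_; _⊎-dec_; ⌊_⌋)
open import Defs hiding (sym)

-- Distance levels and the tree of parents

adj-sym : ∀ {n} (G : Graph n) {u v} → Adj G u v → Adj G v u
adj-sym G {u} {v} = subst T (Defs.sym G u v)

adj-irrefl : ∀ {n} (G : Graph n) {v} → ¬ Adj G v v
adj-irrefl G {v} = subst T (Defs.irrefl G v)

record Layering {n} (G : Graph n) : Set where
  field
    root         : Fin n
    level        : Fin n → ℕ
    parent       : Fin n → Fin n
    level-adj    : ∀ {u v} → Adj G u v → level v ≤ suc (level u)
    level-root   : level root ≡ 0
    level-zero   : ∀ {v} → level v ≡ 0 → v ≡ root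
    parent-adj   : ∀ {v} → v ≢ root → Adj G v (parent v)
    parent-level : ∀ {v} → v ≢ root → level v ≡ suc (level (parent v))
    parent-root  : parent root ≡ root

least : ∀ {P : ℕ → Set} → (∀ k → Dec (P k)) → ∀ k → P k →
        ∃ λ m → P m × (∀ j → P j → m ≤ j)
least P? zero    p = 0 , p , λ _ _ → z≤n
least {P} P? (suc k) p with P? 0
... | yes p₀ = 0 , p₀ , λ _ _ → z≤n
... | no ¬p₀ with least (P? ∘ suc) k p
...   | m , pm , min = suc m , pm , minimal
  where
  minimal : ∀ j → P j → suc m ≤ j
  minimal zero    q = contradiction q ¬p₀
  minimal (suc j) q = s≤s (min j q)

module _ {n} (G : Graph n) (connected : Connected G) (root : Fin n) where

  -- Reachability of the root in at most `k` steps, by recursion on `k`, so that it is decidable and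
  -- `least` can find the distance.
  Within : ℕ → Fin n → Set
  Within zero    v = v ≡ root
  Within (suc k) v = Within k v ⊎ ∃ λ w → Adj G v w × Within k w

  within? : ∀ k v → Dec (Within k v)
  within? zero    v = v ≟ root
  within? (suc k) v = within? k v ⊎-dec any? λ w → T? (adj G v w) ×-dec within? k w

  walk⇒within : ∀ {v} → Walk G v root → ∃ λ k → Within k v
  walk⇒within here        = 0 , refl
  walk⇒within (step a ws) = let k , r = walk⇒within ws in suc k , inj₂ (_ , a , r)

  distance : ∀ v → ∃ λ m → Within m v × (∀ j → Within j v → m ≤ j)
  distance v = let k , r = walk⇒within (connected v root) in least (λ k → within? k v) k r

  dist : Fin n → ℕ
  dist = proj₁ ∘ distance

  dist-within : ∀ v → Within (dist v) v
  dist-within = proj₁ ∘ proj₂ ∘ distance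

  dist-min : ∀ v j → Within j v → dist v ≤ j
  dist-min = proj₂ ∘ proj₂ ∘ distance

  closer : ∀ v → v ≢ root → ∃ λ w → Adj G v w × dist v ≡ suc (dist w)
  closer v v≢r = go (dist v) refl (dist-within v)
    where
    go : ∀ k → dist v ≡ k → Within k v → ∃ λ w → Adj G v w × dist v ≡ suc (dist w)
    go zero    _  v≡r = contradiction v≡r v≢r
    go (suc k) eq (inj₁ r) =
      contradiction (subst (_≤ k) eq (dist-min v k r)) ℕ.1+n≰n
    go (suc k) eq (inj₂ (w , a , r)) = w , a , ℕ.≤-antisym
      (dist-min v _ (inj₂ (w , a , dist-within w)))
      (subst (suc (dist w) ≤_) (sym eq) (s≤s (dist-min w k r)))

  closest : ∀ v → ∃ λ w → (v ≢ root → Adj G v w × dist v ≡ suc (dist w)) × (v ≡ root → w ≡ root)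
  closest v with v ≟ root
  -- The root becomes its own parent, which makes `parent` total.
  ... | yes v≡r = root , contradiction v≡r , λ _ → refl
  ... | no v≢r  = let w , c = closer v v≢r in w , (λ _ → c) , λ v≡r → contradiction v≡r v≢r

  layering : Layering G
  layering = record
    { root         = root
    ; level        = dist
    ; parent       = proj₁ ∘ closest
    ; level-adj    = λ {u} {v} a →
        dist-min v _ (inj₂ (u , adj-sym G a , dist-within u))
    ; level-root   = ℕ.n≤0⇒n≡0 (dist-min root 0 refl)
    ; level-zero   = λ {v} d≡0 → subst (λ k → Within k v) d≡0 (dist-within v)
    ; parent-adj   = λ {v} v≢r → proj₁ (proj₁ (proj₂ (closest v)) v≢r)
    ; parent-level = λ {v} v≢r → proj₂ (proj₁ (proj₂ (closest v)) v≢r)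
    ; parent-root  = proj₂ (proj₂ (closest root)) refl
    }

-- Cycles as lists of vertices

data Consecutive {A : Set} : List A → A → A → Set where
  here  : ∀ {x y l} → Consecutive (x ∷ y ∷ l) x y
  there : ∀ {x y z l} → Consecutive l x y → Consecutive (z ∷ l) x y

lastOf : ∀ {A : Set} → A → List A → A
lastOf x []       = x
lastOf x (y ∷ ys) = lastOf y ys

next-wrap : ∀ {k} (i : Fin (suc k)) → next i ≡ zero → next (suc i) ≡ zero
next-wrap i eq with zero ← next i = refl

next-suc : ∀ {k} (i : Fin (suc k)) → next i ≢ zero → next (suc i) ≡ suc (next i)
next-suc i n≢0 with next i
... | zero  = contradiction refl n≢0
... | suc j = refl

module _ {A : Set} where

  lookup-injective : ∀ {l : List A} → Unique l → ∀ {i j} → lookup l i ≡ lookup l j → i ≡ j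
  lookup-injective (_ ∷ _)   {zero}  {zero}  _  = refl
  lookup-injective (x∉ ∷ _)  {zero}  {suc j} eq = contradiction eq (All.lookup x∉ (∈-lookup j))
  lookup-injective (x∉ ∷ _)  {suc i} {zero}  eq = contradiction (sym eq) (All.lookup x∉ (∈-lookup i))
  lookup-injective (_ ∷ uni) {suc i} {suc j} eq = cong suc (lookup-injective uni eq)

  -- Prepending an entry redirects the wrap-around to the new head, so the two cases record whether
  -- `next i` is zero.
  next-consecutive : ∀ (x : A) xs i →
    (next i ≢ zero × Consecutive (x ∷ xs) (lookup (x ∷ xs) i) (lookup (x ∷ xs) (next i)))
    ⊎ (next i ≡ zero × lookup (x ∷ xs) i ≡ lastOf x xs)
  next-consecutive x []       zero    = inj₂ (refl , refl)
  next-consecutive x (y ∷ ys) zero    = inj₁ ((λ ()) , here)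
  next-consecutive x (y ∷ ys) (suc i) with next i | next-consecutive y ys i
  ... | zero  | inj₁ (z≢z , _)  = contradiction refl z≢z
  ... | zero  | inj₂ (_ , last) = inj₂ (refl , last)
  ... | suc j | inj₁ (_ , c)    = inj₁ ((λ ()) , there c)

  consecutive-next : ∀ {x : A} {xs u v} → Consecutive (x ∷ xs) u v →
    ∃ λ i → next i ≢ zero × lookup (x ∷ xs) i ≡ u × lookup (x ∷ xs) (next i) ≡ v
  consecutive-next here = zero , (λ ()) , refl , refl
  consecutive-next {x} (there {l = y ∷ ys} c) =
    let i , n≢0 , eq , eq′ = consecutive-next c
        n≡ = next-suc i n≢0
    in suc i , subst (_≢ zero) (sym n≡) (λ ()) , eq ,
       trans (cong (lookup (x ∷ y ∷ ys)) n≡) eq′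

  next-last : ∀ (x : A) xs → ∃ λ i → next i ≡ zero × lookup (x ∷ xs) i ≡ lastOf x xs
  next-last x []       = zero , refl , refl
  next-last x (y ∷ ys) = let i , n≡0 , last = next-last y ys in suc i , next-wrap i n≡0 , last

edge-swap : ∀ {n} {G : Graph n} (C : Cycle G) {u v} → CycleEdge C u v → CycleEdge C v u
edge-swap C (i , e) = i , swap e

module _ {n} (G : Graph n) where

  Closed : Fin n → List (Fin n) → Fin n → Fin n → Set
  Closed x xs u v = Consecutive (x ∷ xs) u v ⊎ (u ≡ lastOf x xs × v ≡ x)

  closed-next : ∀ x xs i → Closed x xs (lookup (x ∷ xs) i) (lookup (x ∷ xs) (next i))
  closed-next x xs i with next-consecutive x xs i
  ... | inj₁ (_ , c)      = inj₁ c
  ... | inj₂ (n≡0 , last) = inj₂ (last , cong (lookup (x ∷ xs)) n≡0)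

  next-closed : ∀ {x xs u v} → Closed x xs u v →
    ∃ λ i → lookup (x ∷ xs) i ≡ u × lookup (x ∷ xs) (next i) ≡ v
  next-closed (inj₁ c) = let i , _ , eqs = consecutive-next c in i , eqs
  next-closed {x} {xs} (inj₂ (refl , refl)) =
    let i , n≡0 , last = next-last x xs in i , last , cong (lookup (x ∷ xs)) n≡0

  module ListCycle (x y z : Fin n) (zs : List (Fin n)) (unique : Unique (x ∷ y ∷ z ∷ zs))
                   (closed-adj : ∀ {u v} → Closed x (y ∷ z ∷ zs) u v → Adj G u v) where

    cycle : Cycle G
    cycle = record
      { len   = length zs
      ; vtx   = lookup (x ∷ y ∷ z ∷ zs)
      ; inj   = lookup-injective unique
      ; edges = λ i → closed-adj (closed-next x (y ∷ z ∷ zs) i)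
      }

    closed⇒edge : ∀ {u v} → Closed x (y ∷ z ∷ zs) u v → CycleEdge cycle u v
    closed⇒edge c = let i , eqs = next-closed c in i , inj₁ eqs

    edge⇒closed : ∀ {u v} → CycleEdge cycle u v →
                  Closed x (y ∷ z ∷ zs) u v ⊎ Closed x (y ∷ z ∷ zs) v u
    edge⇒closed (i , inj₁ (refl , refl)) = inj₁ (closed-next x (y ∷ z ∷ zs) i)
    edge⇒closed (i , inj₂ (refl , refl)) = inj₂ (closed-next x (y ∷ z ∷ zs) i)

EdgeDisjointCycles : ∀ {n} → Graph n → Set
EdgeDisjointCycles G = ∀ (C D : Cycle G) → (∃ λ u → ∃ λ v → CycleEdge C u v × CycleEdge D u v) →
  ∀ u v → CycleEdge C u v → CycleEdge D u v

-- Tree paths that meet, and the cycles they close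

module Levels {n} (G : Graph n) (layers : Layering G) where

  open Layering layers

  -- The tree paths climbing from a and b, followed until they meet.
  data Meet (a b : Fin n) : Set where
    apex : parent a ≡ parent b → Meet a b
    rung : parent a ≢ parent b → Meet (parent a) (parent b) → Meet a b

  -- The meeting point is left out: the members are the vertices whose edge to the parent belongs to
  -- the path.
  data _∈ᴹ_ (c : Fin n) : ∀ {a b} → Meet a b → Set where
    left  : ∀ {b} {m : Meet c b} → c ∈ᴹ m
    right : ∀ {a} {m : Meet a c} → c ∈ᴹ m
    above : ∀ {a b} {ne} {m : Meet (parent a) (parent b)} → c ∈ᴹ m → c ∈ᴹ rung {a} {b} ne m

  nonroot : ∀ {v k} → level v ≡ suc k → v ≢ root
  nonroot eq refl = ℕ.0≢1+n (trans (sym level-root) eq)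

  same-level-nonroot : ∀ {a b} → a ≢ b → level a ≡ level b → a ≢ root × b ≢ root
  same-level-nonroot a≢b eq =
    (λ { refl → a≢b (sym (level-zero (trans (sym eq) level-root))) }) ,
    (λ { refl → a≢b (level-zero (trans eq level-root)) })

  parents-level : ∀ {a b} → a ≢ b → level a ≡ level b → level (parent a) ≡ level (parent b)
  parents-level a≢b eq = let a≢r , b≢r = same-level-nonroot a≢b eq in
    ℕ.suc-injective (trans (sym (parent-level a≢r)) (trans eq (parent-level b≢r)))

  -- Level zero holds only the root, so the two climbs must meet before they reach it as distinct
  -- vertices.
  meet : ∀ {a b} → a ≢ b → level a ≡ level b → Meet a b
  meet {a} a≢b eq = go _ refl a≢b eq
    where
    go : ∀ k {a b} → level a ≡ k → a ≢ b → level a ≡ level b → Meet a b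
    go zero    l≡0 a≢b eq = contradiction (level-zero l≡0) (proj₁ (same-level-nonroot a≢b eq))
    go (suc k) {a} {b} l≡k a≢b eq with parent a ≟ parent b
    ... | yes p≡ = apex p≡
    ... | no p≢  = rung p≢
      (go k (ℕ.suc-injective (trans (sym (parent-level (nonroot l≡k))) l≡k)) p≢ (parents-level a≢b eq))

  ∈ᴹ-level : ∀ {a b} {m : Meet a b} → a ≢ b → level a ≡ level b → ∀ {c} → c ∈ᴹ m →
             c ≢ root × level c ≤ level a
  ∈ᴹ-level a≢b eq left  = proj₁ (same-level-nonroot a≢b eq) , ℕ.≤-refl
  ∈ᴹ-level a≢b eq right = proj₂ (same-level-nonroot a≢b eq) , ℕ.≤-reflexive (sym eq)
  ∈ᴹ-level {a} a≢b eq (above {ne = ne} c∈) =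
    let c≢r , c≤ = ∈ᴹ-level ne (parents-level a≢b eq) c∈ in
    c≢r , ℕ.≤-trans c≤ (ℕ.≤-trans (ℕ.n≤1+n _)
      (ℕ.≤-reflexive (sym (parent-level (proj₁ (same-level-nonroot a≢b eq))))))

  -- Chosen together with `rest` so that `path (rung ne m) acc` computes to `a ∷ path m (b ∷ acc)`.
  third : ∀ {a b} → Meet a b → Fin n
  third {a} {b} (apex _)   = b
  third {a} {b} (rung _ m) = parent (parent a)

  rest : ∀ {a b} → Meet a b → List (Fin n) → List (Fin n)
  rest         (apex _)   acc = acc
  rest {a} {b} (rung _ m) acc = third m ∷ rest m (b ∷ acc)

  -- a, parent a, …, the meeting point, …, parent b, b, followed by acc; the split into
  -- third and rest exposes the three vertices that a cycle must have.
  tail path : ∀ {a b} → Meet a b → List (Fin n) → List (Fin n)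
  tail {a} m acc = parent a ∷ third m ∷ rest m acc
  path {a} m acc = a ∷ tail m acc

  path-last : ∀ {a b} (m : Meet a b) acc → lastOf a (tail m acc) ≡ lastOf b acc
  path-last (apex _)   acc = refl
  path-last {b = b} (rung _ m) acc = path-last m (b ∷ acc)

  TreeEdge : Fin n → Fin n → Set
  TreeEdge u v = (u ≢ root × v ≡ parent u) ⊎ (v ≢ root × u ≡ parent v)

  tree-level : ∀ {u v} → TreeEdge u v → level u ≢ level v
  tree-level (inj₁ (u≢r , refl)) eq = ℕ.1+n≢n (trans (sym (parent-level u≢r)) eq)
  tree-level (inj₂ (v≢r , refl)) eq = ℕ.1+n≢n (trans (sym (parent-level v≢r)) (sym eq))

  tree-adj : ∀ {u v} → TreeEdge u v → Adj G u v
  tree-adj (inj₁ (u≢r , refl)) = parent-adj u≢r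
  tree-adj (inj₂ (v≢r , refl)) = adj-sym G (parent-adj v≢r)

  -- The accumulator is arbitrary because the recursion moves `b` into it; the step from `parent b`
  -- down to `b` is then recognised as a tree edge.
  path-consecutive : ∀ {a b} (m : Meet a b) acc → a ≢ b → level a ≡ level b → ∀ {u v} →
    Consecutive (path m acc) u v → TreeEdge u v ⊎ Consecutive (b ∷ acc) u v
  path-consecutive m acc a≢b eq here = inj₁ (inj₁ (proj₁ (same-level-nonroot a≢b eq) , refl))
  path-consecutive (apex p≡) acc a≢b eq (there here) =
    inj₁ (inj₂ (proj₂ (same-level-nonroot a≢b eq) , p≡))
  path-consecutive (apex p≡) acc a≢b eq (there (there c)) = inj₂ c
  path-consecutive {b = b} (rung ne m) acc a≢b eq (there c)
    with path-consecutive m (b ∷ acc) ne (parents-level a≢b eq) c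
  ... | inj₁ t         = inj₁ t
  ... | inj₂ here      = inj₁ (inj₂ (proj₂ (same-level-nonroot a≢b eq) , refl))
  ... | inj₂ (there d) = inj₂ d

  consecutive-path : ∀ {a b} (m : Meet a b) acc {u v} →
    Consecutive (b ∷ acc) u v → Consecutive (path m acc) u v
  consecutive-path (apex _)   acc c = there (there c)
  consecutive-path {b = b} (rung _ m) acc c = there (consecutive-path m (b ∷ acc) (there c))

  ∈ᴹ-consecutive : ∀ {a b} {m : Meet a b} acc {c} → c ∈ᴹ m →
    Consecutive (path m acc) c (parent c) ⊎ Consecutive (path m acc) (parent c) c
  ∈ᴹ-consecutive acc left = inj₁ here
  ∈ᴹ-consecutive {m = apex p≡}  acc {c} right =
    inj₂ (subst (λ x → Consecutive (_ ∷ x ∷ c ∷ acc) (parent c) c) (sym p≡) (there here))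
  ∈ᴹ-consecutive {m = rung _ m} acc right = inj₂ (there (consecutive-path m _ here))
  ∈ᴹ-consecutive acc (above {b = b} c∈) with ∈ᴹ-consecutive (b ∷ acc) c∈
  ... | inj₁ d = inj₁ (there d)
  ... | inj₂ d = inj₂ (there d)

  parent-< : ∀ {v} → v ≢ root → level (parent v) < level v
  parent-< v≢r = ℕ.≤-reflexive (sym (parent-level v≢r))

  <⇒≢ : ∀ {u v} → level u < level v → u ≢ v
  <⇒≢ u<v refl = ℕ.<-irrefl refl u<v

  -- `P` carries what is known of `acc`. In the recursion it gains the case `z ≡ b`, since `b`
  -- enters the accumulator with a level greater than that of `parent a`.
  path-all : ∀ {a b} (m : Meet a b) {acc} → a ≢ b → level a ≡ level b →
    ∀ {P : Fin n → Set} → All P acc → All (λ z → level z ≤ level a ⊎ P z) (path m acc)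
  path-all (apex _) a≢b eq ps =
    inj₁ ℕ.≤-refl ∷ inj₁ (ℕ.<⇒≤ (parent-< (proj₁ (same-level-nonroot a≢b eq)))) ∷
    inj₁ (ℕ.≤-reflexive (sym eq)) ∷ All.map inj₂ ps
  path-all {a} {b} (rung ne m) a≢b eq {P} ps =
    inj₁ ℕ.≤-refl ∷ All.map weaken
      (path-all m ne (parents-level a≢b eq) {λ z → z ≡ b ⊎ P z} (inj₁ refl ∷ All.map inj₂ ps))
    where
    weaken : ∀ {z} → level z ≤ level (parent a) ⊎ (z ≡ b ⊎ P z) → level z ≤ level a ⊎ P z
    weaken (inj₁ z≤)          =
      inj₁ (ℕ.≤-trans z≤ (ℕ.<⇒≤ (parent-< (proj₁ (same-level-nonroot a≢b eq)))))
    weaken (inj₂ (inj₁ refl)) = inj₁ (ℕ.≤-reflexive (sym eq))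
    weaken (inj₂ (inj₂ p))    = inj₂ p

  -- Levels separate the entries: `acc` has greater levels than `a`, and the path between `a` and
  -- `b` has smaller ones.
  path-unique : ∀ {a b} (m : Meet a b) {acc} → a ≢ b → level a ≡ level b →
    Unique acc → All (λ z → level a < level z) acc → Unique (path m acc)
  path-unique {a} {b} (apex p≡) a≢b eq uni above-acc =
    (<⇒≢ pa<a ∘ sym ∷ a≢b ∷ All.map <⇒≢ above-acc) ∷
    (<⇒≢ (subst (level (parent a) <_) eq pa<a) ∷ All.map (<⇒≢ ∘ ℕ.<-trans pa<a) above-acc) ∷
    All.map (<⇒≢ ∘ ℕ.≤-<-trans (ℕ.≤-reflexive (sym eq))) above-acc ∷ uni
    where
    pa<a : level (parent a) < level a
    pa<a = parent-< (proj₁ (same-level-nonroot a≢b eq))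
  path-unique {a} {b} (rung ne m) {acc} a≢b eq uni above-acc =
    All.map distinct
      (path-all m ne (parents-level a≢b eq) {a ≢_} (a≢b ∷ All.map <⇒≢ above-acc)) ∷
    path-unique m ne (parents-level a≢b eq)
      (All.map (<⇒≢ ∘ ℕ.≤-<-trans (ℕ.≤-reflexive (sym eq))) above-acc ∷ uni)
      (subst (level (parent a) <_) eq pa<a ∷ All.map (ℕ.<-trans pa<a) above-acc)
    where
    pa<a : level (parent a) < level a
    pa<a = parent-< (proj₁ (same-level-nonroot a≢b eq))
    distinct : ∀ {z} → level z ≤ level (parent a) ⊎ a ≢ z → a ≢ z
    distinct (inj₁ z≤) = <⇒≢ (ℕ.≤-<-trans z≤ pa<a) ∘ sym
    distinct (inj₂ ne) = ne

  LevelEdge : Fin n → Fin n → Set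
  LevelEdge u v = Adj G u v × level u ≡ level v

  level-edge-≢ : ∀ {u v} → LevelEdge u v → u ≢ v
  level-edge-≢ (e , _) refl = adj-irrefl G e

  -- The tree paths from both ends of an edge inside a level close a cycle with it, and all other
  -- edges of this cycle are tree edges.
  module LevelCycle {u v} (e : LevelEdge u v) where

    u≢v : u ≢ v
    u≢v = level-edge-≢ e

    peak : Meet u v
    peak = meet u≢v (proj₂ e)

    closed-edge : ∀ {x y} → Closed G u (tail peak []) x y → TreeEdge x y ⊎ (x ≡ v × y ≡ u)
    closed-edge (inj₁ c) with path-consecutive peak [] u≢v (proj₂ e) c
    ... | inj₁ t          = inj₁ t
    ... | inj₂ (there ())
    closed-edge (inj₂ (x≡ , y≡)) = inj₂ (trans x≡ (path-last peak []) , y≡)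

    closed-adj : ∀ {x y} → Closed G u (tail peak []) x y → Adj G x y
    closed-adj c with closed-edge c
    ... | inj₁ t             = tree-adj t
    ... | inj₂ (refl , refl) = adj-sym G (proj₁ e)

    open ListCycle G u (parent u) (third peak) (rest peak [])
      (path-unique peak u≢v (proj₂ e) [] []) closed-adj public

    base-edge : CycleEdge cycle u v
    base-edge = edge-swap cycle (closed⇒edge (inj₂ (sym (path-last peak []) , refl)))

    climbing-edge : ∀ {c} → c ∈ᴹ peak → CycleEdge cycle c (parent c)
    climbing-edge c∈ with ∈ᴹ-consecutive [] c∈
    ... | inj₁ d = closed⇒edge (inj₁ d)
    ... | inj₂ d = edge-swap cycle (closed⇒edge (inj₁ d))

    edge-inv : ∀ {x y} → CycleEdge cycle x y → TreeEdge x y ⊎ TreeEdge y x ⊎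
               ((x ≡ v × y ≡ u) ⊎ (y ≡ v × x ≡ u))
    edge-inv c with edge⇒closed c
    ... | inj₁ d with closed-edge d
    ...   | inj₁ t = inj₁ t
    ...   | inj₂ b = inj₂ (inj₂ (inj₁ b))
    edge-inv c | inj₂ d with closed-edge d
    ...   | inj₁ t = inj₂ (inj₁ t)
    ...   | inj₂ b = inj₂ (inj₂ (inj₂ b))

  -- An edge between consecutive levels that is not in the tree closes an even cycle.
  module EvenCycle {v w} (v≢r : v ≢ root) (e : Adj G v w) (lv : level v ≡ suc (level w))
                   (w≢p : parent v ≢ w) where

    same : level (parent v) ≡ level w
    same = ℕ.suc-injective (trans (sym (parent-level v≢r)) lv)

    peak : Meet (parent v) w
    peak = meet w≢p same

    -- The sequence climbs from `parent v`, descends to `w`, steps to `v` and closes at `parent v`.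
    -- All steps but the one from `w` to `v` are tree edges, and that one changes the level by `lv`.
    closed-levels : ∀ {x y} → Closed G (parent v) (tail peak (v ∷ [])) x y →
                    Adj G x y × level x ≢ level y
    closed-levels (inj₁ c) with path-consecutive peak (v ∷ []) w≢p same c
    ... | inj₁ t    = tree-adj t , tree-level t
    ... | inj₂ here = adj-sym G e , λ eq → ℕ.1+n≢n (trans (sym lv) (sym eq))
    ... | inj₂ (there (there ()))
    closed-levels (inj₂ (refl , refl)) rewrite path-last peak (v ∷ []) =
      let t = inj₁ (v≢r , refl) in tree-adj t , tree-level t

    open ListCycle G (parent v) (parent (parent v)) (third peak) (rest peak (v ∷ []))
      (path-unique peak w≢p same ([] ∷ []) (parent-< v≢r ∷ []))
      (proj₁ ∘ closed-levels) public

    climbing-edge : ∀ {c} → c ≡ v ⊎ c ∈ᴹ peak → CycleEdge cycle c (parent c)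
    climbing-edge (inj₁ refl) = closed⇒edge (inj₂ (sym (path-last peak (v ∷ [])) , refl))
    climbing-edge (inj₂ c∈) with ∈ᴹ-consecutive (v ∷ []) c∈
    ... | inj₁ d = closed⇒edge (inj₁ d)
    ... | inj₂ d = edge-swap cycle (closed⇒edge (inj₁ d))

    edge-levels : ∀ {x y} → CycleEdge cycle x y → level x ≢ level y
    edge-levels c with edge⇒closed c
    ... | inj₁ d = proj₂ (closed-levels d)
    ... | inj₂ d = proj₂ (closed-levels d) ∘ sym

  -- Consequences of edge-disjoint cycles

  module _ (disjoint : EdgeDisjointCycles G) where

    -- The cycles of `e` and `e′` share the edge from `c` to its parent, so `e′` lies on the cycle
    -- of `e`, whose only edge inside a level is `e`.
    level-edge-unique : ∀ {u v c c′} (e : LevelEdge u v) → c ∈ᴹ LevelCycle.peak e →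
      LevelEdge c c′ → (c ≡ v × c′ ≡ u) ⊎ (c′ ≡ v × c ≡ u)
    level-edge-unique {c = c} {c′} e c∈ e′ with LevelCycle.edge-inv e
      (disjoint (LevelCycle.cycle e′) (LevelCycle.cycle e)
        (c , parent c , LevelCycle.climbing-edge e′ left , LevelCycle.climbing-edge e c∈)
        c c′ (LevelCycle.base-edge e′))
    ... | inj₁ t        = contradiction (proj₂ e′) (tree-level t)
    ... | inj₂ (inj₁ t) = contradiction (sym (proj₂ e′)) (tree-level t)
    ... | inj₂ (inj₂ b) = b

    level-edge-matching : ∀ {u v w} → LevelEdge u v → LevelEdge u w → w ≡ v
    level-edge-matching e e′ with level-edge-unique e left e′
    ... | inj₁ (u≡v , _) = contradiction u≡v (level-edge-≢ e)
    ... | inj₂ (w≡v , _) = w≡v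

    -- Otherwise the cycle of `e′` would share the edge from `c` to its parent with the even cycle,
    -- which has no edge inside a level.
    no-level-edge : ∀ {v w} (v≢r : v ≢ root) (e : Adj G v w) (lv : level v ≡ suc (level w))
      (w≢p : parent v ≢ w) {c} → c ≡ v ⊎ c ∈ᴹ EvenCycle.peak v≢r e lv w≢p →
      ∀ {c′} → ¬ LevelEdge c c′
    no-level-edge v≢r e lv w≢p {c} c∈ {c′} e′ = EvenCycle.edge-levels v≢r e lv w≢p
      (disjoint (LevelCycle.cycle e′) (EvenCycle.cycle v≢r e lv w≢p)
        (c , parent c , LevelCycle.climbing-edge e′ left , EvenCycle.climbing-edge v≢r e lv w≢p c∈)
        c c′ (LevelCycle.base-edge e′))
      (proj₂ e′)

-- Degree parities, the potential and the bad edges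

odd : ℕ → Bool
odd zero    = false
odd (suc k) = not (odd k)

odd-+ : ∀ m k → odd (m + k) ≡ odd m xor odd k
odd-+ zero    k = refl
odd-+ (suc m) k = trans (cong not (odd-+ m k)) (Bool.not-distribˡ-xor (odd m) (odd k))

xor-false⇒≡ : ∀ {x y} → x xor y ≡ false → x ≡ y
xor-false⇒≡ {false} {false} _ = refl
xor-false⇒≡ {true}  {true}  _ = refl

x≢x-xor-true : ∀ {x y} → y ≡ true → x ≢ x xor y
x≢x-xor-true {false} refl ()
x≢x-xor-true {true}  refl ()

module Potential {n} (G : Graph n) (layers : Layering G) (disjoint : EdgeDisjointCycles G) where

  open Layering layers
  open Levels G layers

  degree : Fin n → ℕ
  degree v = length (filterᵇ (adj G v) (allFin n))

  opaque
    degreeParity : Fin n → Bool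
    degreeParity v = odd (degree v)

  upperMate? : ∀ v → Dec (∃ λ w → (Adj G v w × level v ≡ level w) × v Fin.< w)
  upperMate? v = any? λ w → (T? (adj G v w) ×-dec level v ℕ.≟ level w) ×-dec v Fin.<? w

  twisted : Fin n → Bool
  twisted v = (degreeParity v xor degreeParity (parent v)) ∧ ⌊ upperMate? v ⌋

  -- The number stands for the level, so the recursion follows the parents to the root, which gets
  -- the bit `false`.
  potentialFrom : ℕ → Fin n → Bool
  potentialFrom zero    v = false
  potentialFrom (suc k) v = not (potentialFrom k (parent v)) xor twisted v

  opaque
    potential : Fin n → Bool
    potential v = potentialFrom (level v) v

    potential-parent : ∀ {v} → v ≢ root → potential v ≡ not (potential (parent v)) xor twisted v
    potential-parent {v} v≢r = cong (λ k → potentialFrom k v) (parent-level v≢r)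

  untwisted-parent : ∀ {v} → v ≢ root → twisted v ≡ false → potential v ≡ not (potential (parent v))
  untwisted-parent {v} v≢r eq = trans (potential-parent v≢r)
    (trans (cong (not (potential (parent v)) xor_) eq) (xor-identityʳ _))

  untwisted : ∀ {v} → (∀ {w} → LevelEdge v w → ¬ v Fin.< w) → twisted v ≡ false
  untwisted {v} none with upperMate? v
  ... | yes (w , e , v<w) = contradiction v<w (none e)
  ... | no _              = ∧-zeroʳ _

  twisted-parity : ∀ {v} → degreeParity v ≡ degreeParity (parent v) → twisted v ≡ false
  twisted-parity {v} eq = cong (_∧ ⌊ upperMate? v ⌋)
    (trans (cong (_xor degreeParity (parent v)) eq) (xor-same (degreeParity (parent v))))

  untwisted-parity : ∀ {v w} → LevelEdge v w → v Fin.< w → twisted v ≡ false →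
                     degreeParity v ≡ degreeParity (parent v)
  untwisted-parity {v} e v<w eq with upperMate? v
  ... | yes _    = xor-false⇒≡ (trans (sym (Bool.∧-identityʳ _)) eq)
  ... | no none  = contradiction (_ , e , v<w) none

  -- Without twists the bit flips at every tree edge, and both climbs take equally many steps to the
  -- common vertex.
  meet-potential : ∀ {a b} (m : Meet a b) → a ≢ b → level a ≡ level b →
    (∀ {c} → c ∈ᴹ m → twisted c ≡ false) → potential a ≡ potential b
  meet-potential {a} {b} m a≢b eq flat = trans (untwisted-parent a≢r (flat left))
    (trans (cong not (parents m flat)) (sym (untwisted-parent b≢r (flat right))))
    where
    a≢r = proj₁ (same-level-nonroot a≢b eq)
    b≢r = proj₂ (same-level-nonroot a≢b eq)
    parents : (m : Meet a b) → (∀ {c} → c ∈ᴹ m → twisted c ≡ false) →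
              potential (parent a) ≡ potential (parent b)
    parents (apex p≡)   flat = cong potential p≡
    parents (rung ne m) flat = meet-potential m ne (parents-level a≢b eq) (flat ∘ above)

  level-edge-sym : ∀ {u v} → LevelEdge u v → LevelEdge v u
  level-edge-sym (e , eq) = adj-sym G e , sym eq

  -- If `w` is the parent of `v`, equal degree parities exclude a twist at `v`. Otherwise the edge
  -- closes an even cycle whose climbing vertices have no edge inside their level, hence no twist.
  upward-potential : ∀ {v w} → Adj G v w → level v ≡ suc (level w) →
    degreeParity v ≡ degreeParity w → potential v ≢ potential w
  upward-potential {v} {w} e lv par with parent v ≟ w
  ... | yes refl = λ pot → not-¬ pot (untwisted-parent (nonroot lv) (twisted-parity par))
  ... | no p≢w   = λ pot → not-¬ pot (trans
    (untwisted-parent v≢r (flat (inj₁ refl)))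
    (cong not (meet-potential peak p≢w same (flat ∘ inj₂))))
    where
    v≢r = nonroot lv
    open EvenCycle v≢r e lv p≢w using (peak; same)
    flat : ∀ {c} → c ≡ v ⊎ c ∈ᴹ peak → twisted c ≡ false
    flat c∈ = untwisted (λ e′ _ → no-level-edge disjoint v≢r e lv p≢w c∈ e′)

  -- The climbs have equal length. By `level-edge-unique` no twist occurs on them after the first
  -- step, and `v` is untwisted because its only mate `u` is smaller.
  level-potential : ∀ {u v} → LevelEdge u v → u Fin.< v → potential u ≡ potential v xor twisted u
  level-potential {u} {v} e u<v = trans (potential-parent u≢r)
    (cong (_xor twisted u)
      (trans (cong not (parents (LevelCycle.peak e) (level-edge-unique disjoint e)))
             (sym (untwisted-parent v≢r v-flat))))
    where
    u≢v = level-edge-≢ e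
    u≢r = proj₁ (same-level-nonroot u≢v (proj₂ e))
    v≢r = proj₂ (same-level-nonroot u≢v (proj₂ e))
    v-flat : twisted v ≡ false
    v-flat = untwisted λ e′ v<w →
      Fin.<-asym u<v (subst (v Fin.<_) (level-edge-matching disjoint (level-edge-sym e) e′) v<w)
    parents : (m : Meet u v) →
      (∀ {c c′} → c ∈ᴹ m → LevelEdge c c′ → (c ≡ v × c′ ≡ u) ⊎ (c′ ≡ v × c ≡ u)) →
      potential (parent u) ≡ potential (parent v)
    parents (apex p≡)   unique = cong potential p≡
    parents (rung ne m) unique = meet-potential m ne pl λ c∈ →
      untwisted λ e′ _ → low c∈ (unique (above c∈) e′)
      where
      pl = parents-level u≢v (proj₂ e)
      low : ∀ {c c′} → c ∈ᴹ m → (c ≡ v × c′ ≡ u) ⊎ (c′ ≡ v × c ≡ u) → ⊥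
      low c∈ (inj₁ (refl , _)) = ℕ.<⇒≱
        (ℕ.<-≤-trans (parent-< u≢r) (ℕ.≤-reflexive (proj₂ e)))
        (proj₂ (∈ᴹ-level ne pl c∈))
      low c∈ (inj₂ (_ , refl)) = ℕ.<⇒≱ (parent-< u≢r) (proj₂ (∈ᴹ-level ne pl c∈))

  Bad : Fin n → Fin n → Set
  Bad u v = degreeParity u ≡ degreeParity v × potential u ≡ potential v

  bad-level : ∀ {u v} → Adj G u v → Bad u v → LevelEdge u v
  bad-level {u} {v} e (par , pot) with ℕ.<-cmp (level u) (level v)
  ... | tri< u<v _ _ = contradiction (sym pot)
    (upward-potential (adj-sym G e) (ℕ.≤-antisym (level-adj e) u<v) (sym par))
  ... | tri≈ _ eq _  = e , eq
  ... | tri> _ _ v<u = contradiction pot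
    (upward-potential e (ℕ.≤-antisym (level-adj (adj-sym G e)) v<u) par)

  -- Equal bits on the edge mean that `u` is untwisted. As `u` has a larger mate, this forces the
  -- degree parity of its parent, while the bit flips; so both colours separate `u` from its parent.
  bad-parent : ∀ {u v} → Adj G u v → u Fin.< v → Bad u v →
    ¬ Bad u (parent u) × degreeParity u ≡ degreeParity (parent u)
  bad-parent {u} {v} e u<v bad =
    (λ (_ , pot) → not-¬ pot (untwisted-parent u≢r flat)) , untwisted-parity le u<v flat
    where
    le = bad-level e bad
    u≢r = proj₁ (same-level-nonroot (level-edge-≢ le) (proj₂ le))
    flat : twisted u ≡ false
    flat with twisted u in tw
    ... | false = refl
    ... | true  = contradiction
      (trans (sym (proj₂ bad)) (level-potential le u<v)) (x≢x-xor-true tw)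

-- Counting list entries

count : ∀ {A : Set} → (A → Bool) → List A → ℕ
count p xs = length (filterᵇ p xs)

count-cong : ∀ {A : Set} {p q : A → Bool} xs → (∀ {x} → x ∈ xs → p x ≡ q x) → count p xs ≡ count q xs
count-cong [] _ = refl
count-cong {p = p} {q} (x ∷ xs) eq with p x | q x | eq (here refl)
... | true  | .true  | refl = cong suc (count-cong xs (eq ∘ there))
... | false | .false | refl = count-cong xs (eq ∘ there)

count-suc : ∀ {A : Set} {p q : A → Bool} {y} {xs} → Unique xs → y ∈ xs → p y ≡ true → q y ≡ false →
            (∀ {x} → x ≢ y → p x ≡ q x) → count p xs ≡ suc (count q xs)
count-suc {xs = x ∷ xs} (x∉ ∷ _) (here refl) py qy eq rewrite py | qy =
  cong suc (count-cong xs λ x∈ → eq (All.lookup x∉ x∈ ∘ sym))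
count-suc {p = p} {q} {xs = x ∷ xs} (x∉ ∷ uni) (there y∈) py qy eq
  with p x | q x | eq (All.lookup x∉ y∈)
... | true  | .true  | refl = cong suc (count-suc uni y∈ py qy eq)
... | false | .false | refl = count-suc uni y∈ py qy eq

Colour : Set
Colour = Fin 2

pattern red  = zero
pattern blue = suc zero

count-colours : ∀ {A : Set} (p : A → Bool) (e : A → Colour) xs →
  count p xs ≡ count (λ x → p x ∧ ⌊ e x ≟ red ⌋) xs + count (λ x → p x ∧ ⌊ e x ≟ blue ⌋) xs
count-colours p e [] = refl
count-colours p e (x ∷ xs) with p x | e x
... | false | _    = count-colours p e xs
... | true  | red  = cong suc (count-colours p e xs)
... | true  | blue = trans (cong suc (count-colours p e xs)) (sym (ℕ.+-suc _ _))

-- Repairing all vertices by rank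

-- Vertices are treated in order of decreasing rank, since improving at u may spoil lower ranks.
module _ {S : Set} {n} (rank : Fin n → ℕ) (Good : S → Fin n → Set)
  (improve : ∀ s u → ∃ λ s′ → Good s′ u ×
             (∀ {w} → w ≢ u → rank u ≤ rank w → Good s w → Good s′ w)) where

  -- One round treats a single rank, that with `bound ≡ j + rank w`; greater ranks are done already.
  sweep : ∀ {bound} j xs s → (∀ w → bound < j + rank w → Good s w) →
    ∃ λ s′ → (∀ w → bound < j + rank w → Good s′ w) ×
             (∀ {w} → w ∈ xs → bound ≡ j + rank w → Good s′ w)
  sweep j [] s done = s , done , λ ()
  sweep {bound} j (x ∷ xs) s done with sweep j xs s done | bound ℕ.≟ j + rank x
  ... | s₁ , done₁ , new₁ | no ne  = s₁ , done₁ , λ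
    { (here refl) eq → contradiction eq ne ; (there w∈) eq → new₁ w∈ eq }
  ... | s₁ , done₁ , new₁ | yes eq with improve s₁ x
  ...   | s₂ , good , keep = s₂ , done₂ , new₂
    where
    done₂ : ∀ w → bound < j + rank w → Good s₂ w
    done₂ w b< with w ≟ x
    ... | yes refl = good
    ... | no w≢x   = keep w≢x
      (ℕ.<⇒≤ (ℕ.+-cancelˡ-< j _ _ (subst (_< j + rank w) eq b<))) (done₁ w b<)
    new₂ : ∀ {w} → w ∈ x ∷ xs → bound ≡ j + rank w → Good s₂ w
    new₂ (here refl) _ = good
    new₂ {w} (there w∈) eqw with w ≟ x
    ... | yes refl = good
    ... | no w≢x   = keep w≢x
      (ℕ.≤-reflexive (ℕ.+-cancelˡ-≡ j _ _ (trans (sym eq) eqw))) (new₁ w∈ eqw)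

  descend : ∀ {bound} → (∀ w → rank w ≤ bound) → S →
            ∀ j → ∃ λ s → ∀ w → bound < j + rank w → Good s w
  descend ≤b s zero    = s , λ w b< → contradiction (≤b w) (ℕ.<⇒≱ b<)
  descend {bound} ≤b s (suc j) with descend ≤b s j
  ... | s₁ , done with sweep j (allFin n) s₁ done
  ...   | s₂ , done₂ , new = s₂ , finish
    where
    finish : ∀ w → bound < suc (j + rank w) → Good s₂ w
    finish w b< with ℕ.m≤n⇒m<n∨m≡n (s≤s⁻¹ b<)
    ... | inj₁ lt = done₂ w lt
    ... | inj₂ eq = new (∈-allFin w) eq

  satisfy : S → ∃ λ s → ∀ w → Good s w
  -- After `suc bound` rounds even rank zero is covered.
  satisfy s = let s′ , good = descend ≤b s (suc bound) in s′ , λ w → good w (s≤s (ℕ.m≤m+n bound _))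
    where
    ranks = map rank (allFin n)
    bound = max 0 ranks
    ≤b : ∀ w → rank w ≤ bound
    ≤b w = All.lookup (xs≤max 0 ranks) (∈-map⁺ rank (∈-allFin w))

-- Parities of the two total degrees

-- The vertex colour that gives the red total degree the parity x.
vertexColour : ℕ → Bool → Colour
vertexColour d x = if odd d xor x then red else blue

addOwn : ℕ → Colour → Colour → ℕ
addOwn d own c = d + (if ⌊ own ≟ c ⌋ then 1 else 0)

odd-red : ∀ d x → odd (addOwn d (vertexColour d x) red) ≡ x
odd-red d x with odd d in eq | x
... | true  | true  = trans (cong odd (ℕ.+-identityʳ d)) eq
... | true  | false = trans (cong odd (ℕ.+-comm d 1)) (cong not eq)
... | false | true  = trans (cong odd (ℕ.+-comm d 1)) (cong not eq)
... | false | false = trans (cong odd (ℕ.+-identityʳ d)) eq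

-- The vertex adds one to exactly one colour, so the two total degrees sum to `suc (d + b)`.
odd-blue : ∀ d b x → odd (addOwn b (vertexColour d x) blue) ≡ not (odd (d + b) xor x)
odd-blue d b x rewrite odd-+ d b with odd d | odd b in eq | x
... | true  | true  | true  = trans (cong odd (ℕ.+-comm b 1)) (cong not eq)
... | true  | true  | false = trans (cong odd (ℕ.+-identityʳ b)) eq
... | true  | false | true  = trans (cong odd (ℕ.+-comm b 1)) (cong not eq)
... | true  | false | false = trans (cong odd (ℕ.+-identityʳ b)) eq
... | false | true  | true  = trans (cong odd (ℕ.+-identityʳ b)) eq
... | false | true  | false = trans (cong odd (ℕ.+-comm b 1)) (cong not eq)
... | false | false | true  = trans (cong odd (ℕ.+-identityʳ b)) eq
... | false | false | false = trans (cong odd (ℕ.+-comm b 1)) (cong not eq)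

-- When the vertex leaves a colour together with one of its edges, the total degree drops by two.
two-apart : ∀ m → suc m + 0 ≢ suc (suc m) + 1
two-apart m = ℕ.<⇒≢ (s≤s (ℕ.+-monoʳ-≤ (suc m) z≤n))

-- Recolouring a second edge at a vertex changes the total degree in the colour h of the first one,
-- for one of the two choices of h.
recolour-red-or-blue : ∀ d b x →
  addOwn (suc (suc d)) (vertexColour (suc (suc d)) x) red ≢ addOwn (suc d) (vertexColour (suc d) x) red
  ⊎ addOwn (suc (suc b)) (vertexColour d x) blue ≢ addOwn (suc b) (vertexColour (suc d) x) blue
recolour-red-or-blue d b x with odd d | x
... | true  | true  = inj₂ (two-apart b ∘ sym)
... | true  | false = inj₁ (two-apart d ∘ sym)
... | false | true  = inj₁ (two-apart d ∘ sym)
... | false | false = inj₂ (two-apart b ∘ sym)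

xor-cancelˡ : ∀ x {y z} → x xor y ≡ x xor z → y ≡ z
xor-cancelˡ true  eq = Bool.not-injective eq
xor-cancelˡ false eq = eq

xor-cancelʳ : ∀ z {x y} → x xor z ≡ y xor z → x ≡ y
xor-cancelʳ z {x} {y} eq = xor-cancelˡ z (trans (Bool.xor-comm z x) (trans eq (Bool.xor-comm y z)))

-- The colouring and its free choices

module Colouring {n} (G : Graph n) (layers : Layering G) (disjoint : EdgeDisjointCycles G) where

  open Layering layers
  open Levels G layers
  open Potential G layers disjoint

  opaque

    edgeDegree : (Fin n → Fin n → Colour) → Fin n → Colour → ℕ
    edgeDegree e v c = count (λ w → adj G v w ∧ ⌊ e v w ≟ c ⌋) (allFin n)

    -- The vertex colour is computed from the red edges, so the parities hold for every edge
    -- colouring `e`.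
    total : (Fin n → Fin n → Colour) → Fin n → Colour → ℕ
    total e v c = addOwn (edgeDegree e v c) (vertexColour (edgeDegree e v red) (potential v)) c

  opaque
    unfolding total

    edgeDegree-cong : ∀ e e′ {v} → (∀ {w} → Adj G v w → e v w ≡ e′ v w) →
                      ∀ c → edgeDegree e v c ≡ edgeDegree e′ v c
    edgeDegree-cong e e′ {v} eq c = count-cong (allFin n) λ {w} _ → agree w
      where
      agree : ∀ w → adj G v w ∧ ⌊ e v w ≟ c ⌋ ≡ adj G v w ∧ ⌊ e′ v w ≟ c ⌋
      agree w with adj G v w in a
      ... | false = refl
      ... | true  = cong (λ d → ⌊ d ≟ c ⌋) (eq (subst T (sym a) _))

    total-cong : ∀ {e e′ v} → (∀ {w} → Adj G v w → e v w ≡ e′ v w) → ∀ c → total e v c ≡ total e′ v c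
    total-cong {e} {e′} {v} eq c = cong₂ (λ d r → addOwn d (vertexColour r (potential v)) c)
      (edgeDegree-cong e e′ eq c) (edgeDegree-cong e e′ eq red)

    edgeDegree-suc : ∀ {e e′ v y c} → Adj G v y → e v y ≡ c → e′ v y ≢ c →
      (∀ {w} → w ≢ y → Adj G v w → e v w ≡ e′ v w) → edgeDegree e v c ≡ suc (edgeDegree e′ v c)
    edgeDegree-suc {e} {e′} {v} {y} {c} a e≡ e′≢ eq =
      count-suc (allFin⁺ n) (∈-allFin y) gained lost (λ {w} → agree w)
      where
      gained : adj G v y ∧ ⌊ e v y ≟ c ⌋ ≡ true
      gained with true ← adj G v y | e v y ≟ c
      ... | yes _ = refl
      ... | no ≢c = contradiction e≡ ≢c
      lost : adj G v y ∧ ⌊ e′ v y ≟ c ⌋ ≡ false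
      lost with true ← adj G v y | e′ v y ≟ c
      ... | yes ≡c = contradiction ≡c e′≢
      ... | no _   = refl
      agree : ∀ w → w ≢ y → adj G v w ∧ ⌊ e v w ≟ c ⌋ ≡ adj G v w ∧ ⌊ e′ v w ≟ c ⌋
      agree w w≢y with adj G v w in aw
      ... | false = refl
      ... | true  = cong (λ d → ⌊ d ≟ c ⌋) (eq w≢y (subst T (sym aw) _))

  opaque
    unfolding total

    red-separates : ∀ {e u v} → potential u ≢ potential v → total e u red ≢ total e v red
    red-separates {e} {u} {v} ne eq = ne (trans (sym (odd-red (edgeDegree e u red) _))
      (trans (cong odd eq) (odd-red (edgeDegree e v red) _)))

  opaque
    unfolding total degreeParity

    blue-parity : ∀ e v → odd (total e v blue) ≡ not (degreeParity v xor potential v)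
    blue-parity e v = trans (odd-blue (edgeDegree e v red) (edgeDegree e v blue) (potential v))
      (cong (λ d → not (odd d xor potential v)) (sym (count-colours (adj G v) (e v) (allFin n))))

  blue-separates : ∀ {e u v} → degreeParity u xor potential u ≢ degreeParity v xor potential v →
                   total e u blue ≢ total e v blue
  blue-separates {e} {u} {v} ne eq = ne (Bool.not-injective
    (trans (sym (blue-parity e u)) (trans (cong odd eq) (blue-parity e v))))

  -- Colours of the bad edge to a larger vertex and of the edge to the parent.
  Choices : Set
  Choices = Fin n → Colour × Colour

  smaller : Fin n → Fin n → Fin n
  smaller u v with u Fin.<? v
  ... | yes _ = u
  ... | no _  = v

  smaller-< : ∀ {u v} → u Fin.< v → smaller u v ≡ u
  smaller-< {u} {v} u<v with u Fin.<? v
  ... | yes _  = refl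
  ... | no u≮v = contradiction u<v u≮v

  smaller-sym : ∀ u v → smaller u v ≡ smaller v u
  smaller-sym u v with u Fin.<? v | v Fin.<? u
  ... | yes u<v | yes v<u = contradiction v<u (Fin.<-asym u<v)
  ... | yes _   | no _    = refl
  ... | no _    | yes _   = refl
  ... | no u≮v  | no v≮u with Fin.<-cmp u v
  ...   | tri< u<v _ _    = contradiction u<v u≮v
  ...   | tri≈ _ u≡v _    = sym u≡v
  ...   | tri> _ _ v<u    = contradiction v<u v≮u

  treeColour : Choices → Fin n → Fin n → Colour
  treeColour k u v with v ≟ parent u | u ≟ parent v
  ... | yes _ | _     = proj₂ (k u)
  ... | no _  | yes _ = proj₂ (k v)
  -- The tree colour is consulted only where both colours separate, so this value is arbitrary.
  ... | no _  | no _  = red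

  parent-antisym : ∀ {u v} → v ≡ parent u → u ≡ parent v → u ≡ v
  parent-antisym {u} {v} v≡ u≡ with u ≟ root | v ≟ root
  ... | yes refl | _        = sym (trans v≡ parent-root)
  ... | no _     | yes refl = trans u≡ parent-root
  ... | no u≢r   | no v≢r   = contradiction
    (subst (λ x → level x < level u) (sym v≡) (parent-< u≢r))
    (ℕ.<-asym (subst (λ x → level x < level v) (sym u≡) (parent-< v≢r)))

  treeColour-sym : ∀ k u v → treeColour k u v ≡ treeColour k v u
  treeColour-sym k u v with v ≟ parent u | u ≟ parent v
  ... | yes v≡ | yes u≡ = cong (proj₂ ∘ k) (parent-antisym v≡ u≡)
  ... | yes _  | no _   = refl
  ... | no _   | yes _  = refl
  ... | no _   | no _   = refl

  treeColour-parent : ∀ k u → treeColour k u (parent u) ≡ proj₂ (k u)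
  treeColour-parent k u with parent u ≟ parent u | u ≟ parent (parent u)
  ... | yes _  | _ = refl
  ... | no ne  | _ = contradiction refl ne

  opaque

    edgeColour : Choices → Fin n → Fin n → Colour
    edgeColour k u v with degreeParity u Bool.≟ degreeParity v | potential u Bool.≟ potential v
    ... | yes _ | yes _ = proj₁ (k (smaller u v))
    ... | yes _ | no _  = treeColour k u v
    -- With different degree parities exactly one colour has totals of different parity: blue for
    -- equal bits, red for different ones.
    ... | no _  | yes _ = blue
    ... | no _  | no _  = red

  opaque
    unfolding edgeColour

    edgeColour-sym : ∀ k u v → edgeColour k u v ≡ edgeColour k v u
    edgeColour-sym k u v
      with degreeParity u Bool.≟ degreeParity v | potential u Bool.≟ potential v
         | degreeParity v Bool.≟ degreeParity u | potential v Bool.≟ potential u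
    ... | yes _ | yes _ | yes _ | yes _ = cong (proj₁ ∘ k) (smaller-sym u v)
    ... | yes _ | no _  | yes _ | no _  = treeColour-sym k u v
    ... | no _  | yes _ | no _  | yes _ = refl
    ... | no _  | no _  | no _  | no _  = refl
    ... | yes p | _     | no q  | _     = contradiction (sym p) q
    ... | no p  | _     | yes q | _     = contradiction (sym q) p
    ... | _     | yes p | _     | no q  = contradiction (sym p) q
    ... | _     | no p  | _     | yes q = contradiction (sym q) p

    edgeColour-bad : ∀ k {u v} → u Fin.< v → Bad u v → edgeColour k u v ≡ proj₁ (k u)
    edgeColour-bad k {u} {v} u<v (par , pot)
      with degreeParity u Bool.≟ degreeParity v | potential u Bool.≟ potential v
    ... | yes _ | yes _ = cong (proj₁ ∘ k) (smaller-< u<v)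
    ... | yes _ | no q  = contradiction pot q
    ... | no q  | _     = contradiction par q

    edgeColour-parent : ∀ k {u} → ¬ Bad u (parent u) → degreeParity u ≡ degreeParity (parent u) →
                        edgeColour k u (parent u) ≡ proj₂ (k u)
    edgeColour-parent k {u} ok par
      with degreeParity u Bool.≟ degreeParity (parent u) | potential u Bool.≟ potential (parent u)
    ... | yes _ | yes q = contradiction (par , q) ok
    ... | yes _ | no _  = treeColour-parent k u
    ... | no q  | _     = contradiction par q

    -- The hypotheses list every place where the colour of an edge consults the choices.
    edgeColour-cong : ∀ {k k′ : Choices} {u v} →
      (Bad u v → proj₁ (k (smaller u v)) ≡ proj₁ (k′ (smaller u v))) →
      (v ≡ parent u → proj₂ (k u) ≡ proj₂ (k′ u)) →
      (u ≡ parent v → proj₂ (k v) ≡ proj₂ (k′ v)) →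
      edgeColour k u v ≡ edgeColour k′ u v
    edgeColour-cong {u = u} {v} bad up down
      with degreeParity u Bool.≟ degreeParity v | potential u Bool.≟ potential v
    ... | yes p | yes q = bad (p , q)
    ... | no _  | yes _ = refl
    ... | no _  | no _  = refl
    ... | yes _ | no _ with v ≟ parent u | u ≟ parent v
    ...   | yes v≡ | _      = up v≡
    ...   | no _   | yes u≡ = down u≡
    ...   | no _   | no _   = refl

  bad? : ∀ u v → Dec (Bad u v)
  bad? u v = (degreeParity u Bool.≟ degreeParity v) ×-dec (potential u Bool.≟ potential v)

  -- Each bad edge is charged to its smaller end, whose first choice is its colour.
  Good : Choices → Fin n → Set
  Good k u = ∀ {v} → Adj G u v → u Fin.< v → Bad u v →
    total (edgeColour k) u (proj₁ (k u)) ≢ total (edgeColour k) v (proj₁ (k u))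

  -- Repairing one bad edge

  module Fix (k : Choices) {u v} (e : Adj G u v) (u<v : u Fin.< v) (bad : Bad u v) where

    lev : LevelEdge u v
    lev = bad-level e bad

    mate : ∀ {w} → Adj G u w → Bad u w → w ≡ v
    mate a b = level-edge-matching disjoint lev (bad-level a b)

    u≢v : u ≢ v
    u≢v = level-edge-≢ lev

    u≢root : u ≢ root
    u≢root = proj₁ (same-level-nonroot u≢v (proj₂ lev))

    p : Fin n
    p = parent u

    p<u : level p < level u
    p<u = parent-< u≢root

    set : Colour → Colour → Choices
    set h g = updateAt k u (const (h , g))

    set-u : ∀ h g → set h g u ≡ (h , g)
    set-u h g = updateAt-updates u k

    set-other : ∀ h g {w} → w ≢ u → set h g w ≡ k w
    set-other h g {w} w≢u = updateAt-minimal w u k w≢u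

    set-others : ∀ {h g h′ g′ w} → w ≢ u → set h g w ≡ set h′ g′ w
    set-others w≢u = trans (set-other _ _ w≢u) (sym (set-other _ _ w≢u))

    uv-colour : ∀ h g → edgeColour (set h g) u v ≡ h
    uv-colour h g = trans (edgeColour-bad (set h g) u<v bad) (cong proj₁ (set-u h g))

    up-colour : ∀ h g → edgeColour (set h g) u p ≡ g
    up-colour h g = trans
      (edgeColour-parent (set h g) (proj₁ (bad-parent e u<v bad)) (proj₂ (bad-parent e u<v bad)))
      (cong proj₂ (set-u h g))

    above-u : ∀ {w} → level u ≤ level w → w ≡ p → ⊥
    above-u u≤w refl = ℕ.<⇒≱ p<u u≤w

    -- The parent of `u` has a smaller level than `u`, so `w` is not that parent.
    child-other : ∀ {w} → level u ≤ level w → ∀ {y} → w ≡ parent y → y ≢ u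
    child-other u≤w w≡ refl = above-u u≤w w≡

    same-first : ∀ h {g g′} x → proj₁ (set h g x) ≡ proj₁ (set h g′ x)
    same-first h x with x ≟ u
    ... | yes refl = trans (cong proj₁ (set-u h _)) (sym (cong proj₁ (set-u h _)))
    ... | no x≢u   = cong proj₁ (set-others x≢u)

    same-second : ∀ {h h′} g x → proj₂ (set h g x) ≡ proj₂ (set h′ g x)
    same-second g x with x ≟ u
    ... | yes refl = trans (cong proj₂ (set-u _ g)) (sym (cong proj₂ (set-u _ g)))
    ... | no x≢u   = cong proj₂ (set-others x≢u)

    -- At `u` only the edge to the parent follows the second choice; edges to children follow the
    -- choices of the children.
    vary-second : ∀ h {g g′} c → g ≡ c → g′ ≢ c →
      edgeDegree (edgeColour (set h g)) u c ≡ suc (edgeDegree (edgeColour (set h g′)) u c)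
    vary-second h {g} {g′} c g≡c g′≢c = edgeDegree-suc (parent-adj u≢root)
      (trans (up-colour h g) g≡c) (g′≢c ∘ trans (sym (up-colour h g′)))
      λ w≢p a → edgeColour-cong (λ _ → same-first h _) (λ w≡p → contradiction w≡p w≢p)
        (λ _ → cong proj₂ (set-others λ { refl → adj-irrefl G a }))

    -- By the matching property `uv` is the only bad edge at `u`.
    vary-first : ∀ {h h′} g c → h ≡ c → h′ ≢ c →
      edgeDegree (edgeColour (set h g)) u c ≡ suc (edgeDegree (edgeColour (set h′ g)) u c)
    vary-first {h} {h′} g c h≡c h′≢c = edgeDegree-suc e
      (trans (uv-colour h g) h≡c) (h′≢c ∘ trans (sym (uv-colour h′ g)))
      λ w≢v a → edgeColour-cong (λ b → contradiction (mate a b) w≢v)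
        (λ _ → same-second g _) (λ _ → same-second g _)

    -- Being on the level of `u`, `v` is not its parent, so the edge coloured by the second choice
    -- avoids `v`.
    v-fixed : ∀ h {g g′} c → total (edgeColour (set h g)) v c ≡ total (edgeColour (set h g′)) v c
    v-fixed h c = total-cong (λ _ → edgeColour-cong (λ _ → same-first h _)
      (λ _ → cong proj₂ (set-others (u≢v ∘ sym)))
      (λ v≡ → cong proj₂ (set-others (child-other (ℕ.≤-reflexive (proj₂ lev)) v≡)))) c

    -- The total degree of v does not depend on the second choice, that of u does.
    choose-second : ∀ h →
      total (edgeColour (set h red)) u h ≢ total (edgeColour (set h blue)) u h →
      ∃ λ g → total (edgeColour (set h g)) u h ≢ total (edgeColour (set h g)) v h
    choose-second h ne with total (edgeColour (set h red)) u h ℕ.≟ total (edgeColour (set h red)) v h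
    ... | no ≢v  = red , ≢v
    ... | yes ≡v = blue , λ eq → ne (trans ≡v (trans (v-fixed h h) (sym eq)))

    R B : Colour → Colour → ℕ
    R h g = edgeDegree (edgeColour (set h g)) u red
    B h g = edgeDegree (edgeColour (set h g)) u blue

    opaque
      unfolding total

      effective : ∃ λ h → total (edgeColour (set h red)) u h ≢ total (edgeColour (set h blue)) u h
      -- `R blue blue` and `B red red` count the red and the blue edges at `u` other than the two to
      -- be recoloured.
      effective with recolour-red-or-blue (R blue blue) (B red red) (potential u)
      ... | inj₁ ne = red , subst₂ _≢_
        (cong (λ r → addOwn r (vertexColour r (potential u)) red) (sym rr))
        (cong (λ r → addOwn r (vertexColour r (potential u)) red) (sym rb)) ne
        where
        rb : R red blue ≡ suc (R blue blue)
        rb = vary-first blue red refl λ ()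
        rr : R red red ≡ suc (suc (R blue blue))
        rr = trans (vary-second red red refl λ ()) (cong suc rb)
      ... | inj₂ ne = blue , subst₂ _≢_
        (cong₂ (λ b r → addOwn b (vertexColour r (potential u)) blue) (sym br) (sym Rbr))
        (cong (λ b → addOwn b (vertexColour (R blue blue) (potential u)) blue) (sym bb)) (ne ∘ sym)
        where
        br : B blue red ≡ suc (B red red)
        br = vary-first red blue refl λ ()
        bb : B blue blue ≡ suc (suc (B red red))
        bb = trans (vary-second blue blue refl λ ()) (cong suc br)
        Rbr : R blue red ≡ suc (R blue blue)
        Rbr = vary-second blue red refl λ ()

    choice : ∃ λ h → ∃ λ g → total (edgeColour (set h g)) u h ≢ total (edgeColour (set h g)) v h
    choice = let h , ne = effective in h , choose-second h ne

    choices : Choices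
    choices = set (proj₁ choice) (proj₁ (proj₂ choice))

    choices-other : ∀ {w} → w ≢ u → choices w ≡ k w
    choices-other = set-other _ _

    good : Good choices u
    good a _ b rewrite mate a b | set-u (proj₁ choice) (proj₁ (proj₂ choice)) = proj₂ (proj₂ choice)

    -- The only possible bad edge at `w` is the one to `w′`, charged to a vertex other than `u`; the
    -- edge to the parent follows `w` itself, and `u` is no child of `w`.
    unaffected : ∀ {w w′} → LevelEdge w w′ → w ≢ u → level u ≤ level w → smaller w w′ ≢ u →
      ∀ c → total (edgeColour k) w c ≡ total (edgeColour choices) w c
    unaffected ww′ w≢u u≤w s≢u = total-cong λ a → edgeColour-cong
      (λ b → cong proj₁ (sym (choices-other
        (subst (λ y → smaller _ y ≢ u) (sym (level-edge-matching disjoint ww′ (bad-level a b))) s≢u))))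
      (λ _ → cong proj₂ (sym (choices-other w≢u)))
      (λ w≡ → cong proj₂ (sym (choices-other (child-other u≤w w≡))))

    keep : ∀ {w} → w ≢ u → level u ≤ level w → Good k w → Good choices w
    keep {w} w≢u u≤w good-w {w′} a w<w′ b rewrite choices-other w≢u =
      subst₂ _≢_ (unaffected ww′ w≢u u≤w s≢u _)
        (unaffected (level-edge-sym ww′) w′≢u (ℕ.≤-trans u≤w (ℕ.≤-reflexive (proj₂ ww′)))
          (s≢u ∘ trans (smaller-sym w w′)) _)
        (good-w a w<w′ b)
      where
      ww′ : LevelEdge w w′
      ww′ = bad-level a b
      s≢u : smaller w w′ ≢ u
      s≢u = w≢u ∘ trans (sym (smaller-< w<w′))
      w′≢u : w′ ≢ u
      -- If `w′` were `u`, its mate `w` would be `v`, against `w < w′` and `u < v`.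
      w′≢u refl = Fin.<-asym u<v
        (subst (Fin._< u) (level-edge-matching disjoint lev (level-edge-sym ww′)) w<w′)

  improve : ∀ k u → ∃ λ k′ → Good k′ u ×
            (∀ {w} → w ≢ u → level u ≤ level w → Good k w → Good k′ w)
  improve k u with any? (λ v → T? (adj G u v) ×-dec u Fin.<? v ×-dec bad? u v)
  ... | yes (v , e , u<v , bad) = let open Fix k e u<v bad in choices , good , keep
  ... | no none = k , (λ a u<v b → contradiction (_ , a , u<v , b) none) , λ _ _ good → good

  good-choices : ∃ λ k → ∀ u → Good k u
  good-choices = satisfy level Good improve (λ _ → red , red)

  -- Every edge is separated

  opaque
    unfolding edgeColour

    separates-ordered : ∀ {k} → (∀ u → Good k u) → ∀ {u v} → Adj G u v → u Fin.< v →
      total (edgeColour k) u (edgeColour k u v) ≢ total (edgeColour k) v (edgeColour k u v)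
    separates-ordered {k} good {u} {v} a u<v with bad? u v
    ... | yes bad rewrite edgeColour-bad k u<v bad = good u a u<v bad
    ... | no ok with degreeParity u Bool.≟ degreeParity v | potential u Bool.≟ potential v
    ...   | yes p | yes q = contradiction (p , q) ok
    ...   | no p  | yes q = blue-separates {edgeColour k}
      λ eq → p (xor-cancelʳ (potential u) (trans eq (cong (degreeParity v xor_) (sym q))))
    ...   | no _  | no q  = red-separates {edgeColour k} q
    ...   | yes p | no q with treeColour k u v
    ...     | red  = red-separates {edgeColour k} q
    ...     | blue = blue-separates {edgeColour k}
      λ eq → q (xor-cancelˡ (degreeParity u) (trans eq (cong (_xor potential v) (sym p))))

  coloring : Choices → TotalColoring G 2
  coloring k = record
    { vcol    = λ v → vertexColour (edgeDegree (edgeColour k) v red) (potential v)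
    ; ecol    = edgeColour k
    ; ecolSym = edgeColour-sym k
    }

  opaque
    unfolding total

    -- With `total` unfolded, `tdeg` of the colouring is `total` by computation; symmetry then
    -- allows the ends to be ordered.
    separates : ∀ {k} → (∀ u → Good k u) → IsTLIR (coloring k)
    separates {k} good u v a with Fin.<-cmp u v
    ... | tri< u<v _ _  = separates-ordered good a u<v
    ... | tri≈ _ refl _ = contradiction a (adj-irrefl G)
    ... | tri> _ _ v<u rewrite edgeColour-sym k u v = separates-ordered good (adj-sym G a) v<u ∘ sym

  tlir : TlirAtMost G 2
  tlir = let k , good = good-choices in coloring k , separates good

theorem1 : ∀ {n : ℕ} (G : Graph n) → Cactus G → TlirAtMost G 2
-- Without vertices there is no root for the levels.
theorem1 {zero}  G _ =
  record { vcol = λ () ; ecol = λ () ; ecolSym = λ () } , λ ()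
theorem1 {suc n} G (connected , disjoint) =
  Colouring.tlir G (layering G connected zero) disjoint
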